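{- Let $\ell \ge k \ge 2$ be integers. Then for all integers $n \ge k+\ell$, $$\mathrm{sat}^*(n,K_{k,\ell})\le \left(k-1+\frac{(k(k-1)+1)(\ell-1)}{2}\right)n-\frac{(k(k-1)^2+1)(\ell-1)+k(k-1)}{2}.$$
   Context: All graphs are finite and simple; $K_{k,\ell}$ is the complete bipartite graph with parts of sizes $k$ and $\ell$. An edge-colouring of a graph is proper if incident edges receive different colours, and a subgraph is rainbow if all of its edges receive pairwise distinct colours. A graph $G$ is properly rainbow $H$-saturated if (1) there is a proper edge-colouring of $G$ (with any set of colours) containing no rainbow copy of $H$, and (2) for every edge $e$ of the complement $\overline{G}$, every proper edge-colouring of $G+e$ contains a rainbow copy of $H$. The proper rainbow saturation number $\mathrm{sat}^*(n,H)$ is the minimum number of edges in an $n$-vertex properly rainbow $H$-saturated graph. -}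

module Defs where

open import Data.Bool using (Bool; true; false; T; _∧_; _∨_; _xor_; if_then_else_)
open import Data.Bool.Properties using (∧-comm; ∨-comm; xor-comm; xor-same)
open import Data.Fin using (Fin; _<?_; _≟_; splitAt)
open import Data.Integer using (+_)
open import Data.Nat using (ℕ; _≤_; _+_)
open import Data.Nat.Properties using (+-0-commutativeMonoid)
open import Algebra.Properties.CommutativeMonoid.Sum +-0-commutativeMonoid using (sum)
open import Data.Product using (Σ-syntax; _×_; _,_)
open import Data.Rational.Unnormalised using (ℚᵘ; _/_)
open import Data.Sum using (_⊎_; [_,_]′)
open import Function using (const; Injective)
open import Relation.Binary.PropositionalEquality
  using (_≡_; _≢_; refl; cong₂; module ≡-Reasoning)
open import Relation.Nullary using (¬_; yes; no; contradiction)
open import Relation.Nullary.Decidable using (⌊_⌋)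

record Graph (n : ℕ) : Set where
  field
    adj        : Fin n → Fin n → Bool
    adj-sym    : ∀ u v → adj u v ≡ adj v u
    adj-irrefl : ∀ u → adj u u ≡ false

  Adj : Fin n → Fin n → Set
  Adj u v = T (adj u v)

open Graph public

-- Each edge is counted once, at its pair of endpoints in increasing order.
edgeCount : ∀ {n} → Graph n → ℕ
edgeCount G =
  sum λ u → sum λ v → if ⌊ u <? v ⌋ ∧ adj G u v then 1 else 0

completeBipartite : (k ℓ : ℕ) → Graph (k + ℓ)
completeBipartite k ℓ = record
  { adj        = λ u v → left u xor left v
  ; adj-sym    = λ u v → xor-comm (left u) (left v)
  ; adj-irrefl = λ u → xor-same (left u)
  }
  where
  left : Fin (k + ℓ) → Bool
  left u = [ const true , const false ]′ (splitAt k u)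

addEdge : ∀ {n} → Graph n → (u v : Fin n) → u ≢ v → Graph n
addEdge {n} G u v u≢v = record
  { adj        = λ x y → adj G x y ∨ new x y
  ; adj-sym    = λ x y → cong₂ _∨_ (adj-sym G x y) (new-sym x y)
  ; adj-irrefl = λ x → cong₂ _∨_ (adj-irrefl G x) (new-irrefl x)
  }
  where
  new : Fin n → Fin n → Bool
  new x y = (⌊ x ≟ u ⌋ ∧ ⌊ y ≟ v ⌋) ∨ (⌊ x ≟ v ⌋ ∧ ⌊ y ≟ u ⌋)

  new-sym : ∀ x y → new x y ≡ new y x
  new-sym x y = begin
    (⌊ x ≟ u ⌋ ∧ ⌊ y ≟ v ⌋) ∨ (⌊ x ≟ v ⌋ ∧ ⌊ y ≟ u ⌋)
      ≡⟨ cong₂ _∨_ (∧-comm ⌊ x ≟ u ⌋ _) (∧-comm ⌊ x ≟ v ⌋ _) ⟩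
    (⌊ y ≟ v ⌋ ∧ ⌊ x ≟ u ⌋) ∨ (⌊ y ≟ u ⌋ ∧ ⌊ x ≟ v ⌋)
      ≡⟨ ∨-comm (⌊ y ≟ v ⌋ ∧ ⌊ x ≟ u ⌋) _ ⟩
    (⌊ y ≟ u ⌋ ∧ ⌊ x ≟ v ⌋) ∨ (⌊ y ≟ v ⌋ ∧ ⌊ x ≟ u ⌋) ∎
    where open ≡-Reasoning

  new-irrefl : ∀ x → new x x ≡ false
  new-irrefl x with x ≟ u | x ≟ v
  ... | yes refl | yes refl = contradiction refl u≢v
  ... | yes _    | no _     = refl
  ... | no _     | yes _    = refl
  ... | no _     | no _     = refl

-- Colours are natural numbers, which lose no generality since graphs are
-- finite.  The colour of the edge uv is `colour u v`; values of `colour`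
-- at non-adjacent pairs are junk and are never used.
record ProperColouring {n : ℕ} (G : Graph n) : Set where
  field
    colour     : Fin n → Fin n → ℕ
    colour-sym : ∀ u v → Adj G u v → colour u v ≡ colour v u
    proper     : ∀ u v w → Adj G u v → Adj G u w → v ≢ w → colour u v ≢ colour u w

open ProperColouring public

SameEdge : ∀ {n} → Fin n → Fin n → Fin n → Fin n → Set
SameEdge a b c d = (a ≡ c × b ≡ d) ⊎ (a ≡ d × b ≡ c)

-- A not necessarily induced subgraph of G isomorphic to H, given by an
-- embedding of the vertices of H.
record RainbowCopy {h n : ℕ} (H : Graph h) {G : Graph n} (χ : ProperColouring G) : Set where
  field
    embed     : Fin h → Fin n
    injective : Injective _≡_ _≡_ embed
    edges     : ∀ a b → Adj H a b → Adj G (embed a) (embed b)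
    rainbow   : ∀ a b c d → Adj H a b → Adj H c d → ¬ SameEdge a b c d →
                colour χ (embed a) (embed b) ≢ colour χ (embed c) (embed d)

ProperlyRainbowSaturated : ∀ {h n} → Graph h → Graph n → Set
ProperlyRainbowSaturated H G =
  (Σ[ χ ∈ ProperColouring G ] ¬ RainbowCopy H χ)
  × (∀ u v (u≢v : u ≢ v) → ¬ Adj G u v →
     (χ : ProperColouring (addEdge G u v u≢v)) → RainbowCopy H χ)

-- "sat*(n, H) = s", as a relation, because the minimum of a set of naturals
-- is a partial notion.
IsSat* : ∀ {h} (n : ℕ) → Graph h → ℕ → Set
IsSat* n H s =
  (Σ[ G ∈ Graph n ] ProperlyRainbowSaturated H G × edgeCount G ≡ s)
  × (∀ (G : Graph n) → ProperlyRainbowSaturated H G → s ≤ edgeCount G)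

fromℕ : ℕ → ℚᵘ
fromℕ m = + m / 1

module Submission where

-- A graph is properly rainbow H-saturated exactly when it is edge-maximal among
-- the graphs having a proper colouring without a rainbow H, so K_{k-1,r}, which
-- contains no K_{k,ℓ} at all, extends to a saturated graph G on n = k - 1 + r
-- vertices.  The k - 1 vertices of the small part have degree at most n - 1.
-- For any other vertex v, its neighbours outside the small part are joined to v
-- and to all k - 1 of those vertices; each of them has a colour clash with at
-- most k(k - 1) others, so (k(k - 1) + 1)(ℓ - 1) + 1 of them would contain ℓ
-- pairwise clash-free ones, that is, a rainbow K_{k,ℓ}.  Summing degrees bounds
-- the number of edges.  The minimum itself exists because only finitely many
-- graphs and, up to renaming colours, finitely many colourings need be searched.

open import Defs
open import Data.Bool using (Bool; true; false; T; T?; not; _∧_; if_then_else_)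
import Data.Bool.Properties as Boolₚ
open import Data.Empty using (⊥)
open import Data.Fin as Fin
  using (Fin; zero; suc; toℕ; combine; remQuot; finToFun; funToFin; punchOut; splitAt; _↑ˡ_; _↑ʳ_)
import Data.Fin.Properties as Finₚ
open import Data.Integer as ℤ using (+_; -[1+_])
open import Data.Integer.Tactic.RingSolver using (solve-∀)
import Data.Integer.Properties as ℤₚ
open import Data.List using (List; []; _∷_; allFin; cartesianProduct)
open import Data.List.Membership.Propositional using (_∈_)
open import Data.List.Membership.Propositional.Properties using (∈-allFin; ∈-cartesianProduct⁺)
open import Data.List.Relation.Unary.Any using (here; there)
open import Data.Nat as ℕ using (ℕ; zero; suc; z≤n; s≤s)
import Data.Nat.Properties as ℕₚ
open import Data.Product using (Σ-syntax; ∃; ∃-syntax; _×_; _,_; proj₁; proj₂; uncurry)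
open import Data.Rational.Unnormalised using (ℚᵘ; *≤*; ↥_; _≤_; _+_; _*_; _-_; 1ℚᵘ; ½)
open import Data.Sum using (_⊎_; inj₁; inj₂; [_,_]′)
open import Function using (_∘_; Injective; Equivalence; module Inverse)
open import Relation.Binary.PropositionalEquality
open import Relation.Nullary using (¬_; Dec; yes; no; contradiction)
open import Relation.Nullary.Decidable
  using (map′; ¬?; _×-dec_; _⊎-dec_; _→-dec_; decidable-stable; ⌊_⌋; toWitness; fromWitness)
open import Relation.Unary using (Decidable)
open import Algebra.Properties.CommutativeMonoid.Sum ℕₚ.+-0-commutativeMonoid
  using (sum; sum-cong-≗; ∑-comm; ∑-distrib-+)

private variable
  h k ℓ m n o r : ℕ

-- Exhaustive search over finite function spaces

-- Functions are enumerated through their codes in `Fin (n ^ m)`. Decoding a code returns the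
-- function only pointwise, so `P` has to respect `≗`.
any-fun? : {P : (Fin m → Fin n) → Set} → (∀ {f g} → f ≗ g → P f → P g) →
           Decidable P → Dec (∃ P)
any-fun? resp P? =
  map′ (λ (i , p) → finToFun i , p)
       (λ (f , p) → funToFin f , resp (sym ∘ Finₚ.finToFun-funToFin f) p)
       (Finₚ.any? (P? ∘ finToFun))

any-fun₂? : {P : (Fin m → Fin n → Fin o) → Set} →
            (∀ {f g} → (∀ i j → f i j ≡ g i j) → P f → P g) →
            Decidable P → Dec (∃ P)
any-fun₂? {n = n} resp P? =
  map′ (λ (f , p) → (λ i j → f (combine i j)) , p)
       (λ (f , p) → uncurry f ∘ remQuot n ,
          resp (λ i j → cong (uncurry f) (sym (Finₚ.remQuot-combine i j))) p)
       (any-fun? (λ eq → resp λ i j → eq (combine i j)) (λ f → P? λ i j → f (combine i j)))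

least : {P : ℕ → Set} → Decidable P → ∀ m → P m →
        Σ[ s ∈ ℕ ] s ℕ.≤ m × P s × (∀ t → P t → s ℕ.≤ t)
least P? zero p = zero , z≤n , p , λ _ _ → z≤n
least P? (suc m) p with P? zero
... | yes p₀ = zero , z≤n , p₀ , λ _ _ → z≤n
... | no ¬p₀ =
  let s , s≤m , q , min = least (P? ∘ suc) m p
  in suc s , s≤s s≤m , q , λ where
       zero    r → contradiction r ¬p₀
       (suc t) r → s≤s (min t r)

-- Subgraphs and rainbow-free colourings

infix 4 _⊆_

_⊆_ : Graph n → Graph n → Set
G ⊆ G′ = ∀ u v → Adj G u v → Adj G′ u v

⊆-addEdge : (G : Graph n) → ∀ u v u≢v → G ⊆ addEdge G u v u≢v
⊆-addEdge G u v u≢v x y p with adj G x y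
... | true = p

-- The two proofs of `u ≢ v` are independent, so the case of equal graphs also exchanges the proof
-- carried by `addEdge`.
addEdge-mono : {G G′ : Graph n} → G ⊆ G′ → ∀ u v p q → addEdge G u v p ⊆ addEdge G′ u v q
addEdge-mono {G = G} {G′} G⊆G′ u v _ _ x y e with adj G x y | adj G′ x y | G⊆G′ x y
... | _     | true  | _ = _
... | false | false | _ = e
... | true  | false | f = contradiction (f _) λ ()

addEdge-adj : (G : Graph n) → ∀ u v u≢v → Adj (addEdge G u v u≢v) u v
addEdge-adj G u v u≢v with adj G u v | u Fin.≟ u | v Fin.≟ v
... | true  | _      | _      = _
... | false | yes _  | yes _  = _
... | false | no u≢u | _      = contradiction refl u≢u
... | false | yes _  | no v≢v = contradiction refl v≢v

RainbowFree : Graph h → Graph n → Set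
RainbowFree H G = Σ[ χ ∈ ProperColouring G ] ¬ RainbowCopy H χ

restrict : {G G′ : Graph n} → G ⊆ G′ → ProperColouring G′ → ProperColouring G
restrict G⊆G′ χ = record
  { colour     = colour χ
  ; colour-sym = λ u v e → colour-sym χ u v (G⊆G′ u v e)
  ; proper     = λ u v w e f → proper χ u v w (G⊆G′ u v e) (G⊆G′ u w f)
  }

rainbowFree-antitone : {H : Graph h} {G G′ : Graph n} → G ⊆ G′ → RainbowFree H G′ → RainbowFree H G
rainbowFree-antitone G⊆G′ (χ , free) = restrict G⊆G′ χ , λ R → free (record
  { embed     = RainbowCopy.embed R
  ; injective = RainbowCopy.injective R
  ; edges     = λ a b e → G⊆G′ _ _ (RainbowCopy.edges R a b e)
  ; rainbow   = RainbowCopy.rainbow R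
  })

-- Deciding whether a rainbow-free colouring exists

rainbowCopy? : (H : Graph h) {G : Graph n} (χ : ProperColouring G) → Dec (RainbowCopy H χ)
rainbowCopy? {h} {n} H {G} χ =
  map′ (λ (e , inj , edg , rb) → record
         { embed = e ; injective = inj _ _ ; edges = edg ; rainbow = rb })
       (λ R → let open RainbowCopy R in
         embed , (λ _ _ → injective) , edges , rainbow)
       (any-fun? respects λ e →
         (Finₚ.all? λ a → Finₚ.all? λ b → (e a Fin.≟ e b) →-dec (a Fin.≟ b))
         ×-dec (Finₚ.all? λ a → Finₚ.all? λ b →
           T? (adj H a b) →-dec T? (adj G (e a) (e b)))
         ×-dec (Finₚ.all? λ a → Finₚ.all? λ b → Finₚ.all? λ c → Finₚ.all? λ d →
           T? (adj H a b) →-dec (T? (adj H c d) →-dec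
           (¬? (((a Fin.≟ c) ×-dec (b Fin.≟ d)) ⊎-dec ((a Fin.≟ d) ×-dec (b Fin.≟ c)))
            →-dec ¬? (colour χ (e a) (e b) ℕ.≟ colour χ (e c) (e d))))))
  where
  IsRainbow : (Fin h → Fin n) → Set
  IsRainbow e =
    (∀ a b → e a ≡ e b → a ≡ b)
    × (∀ a b → Adj H a b → Adj G (e a) (e b))
    × (∀ a b c d → Adj H a b → Adj H c d → ¬ SameEdge a b c d →
       colour χ (e a) (e b) ≢ colour χ (e c) (e d))

  respects : ∀ {e e′} → e ≗ e′ → IsRainbow e → IsRainbow e′
  respects eq (inj , edg , rb) =
      (λ a b p → inj a b (trans (eq a) (trans p (sym (eq b)))))
    , (λ a b p → subst₂ (Adj G) (eq a) (eq b) (edg a b p))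
    , (λ a b c d p q r s → rb a b c d p q r
        (trans (cong₂ (colour χ) (eq a) (eq b))
          (trans s (cong₂ (colour χ) (sym (eq c)) (sym (eq d))))))

-- The last index, `m`, is the default for a colour that `f` does not take; hence the codomain
-- `Fin (suc m)`.
firstIndex : (Fin m → ℕ) → ℕ → Fin (suc m)
firstIndex {zero}  f c = zero
firstIndex {suc m} f c with f zero ℕ.≟ c
... | yes _ = zero
... | no  _ = suc (firstIndex (f ∘ suc) c)

-- It is enough that one of the two colours is a value of `f`: its index is then not the default, so
-- the other colour is found at the same place.
firstIndex-injective : (f : Fin m → ℕ) → ∀ i {c} → firstIndex f (f i) ≡ firstIndex f c → f i ≡ c
firstIndex-injective {suc m} f i {c} eq with f zero ℕ.≟ f i | f zero ℕ.≟ c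
... | yes p | yes q = trans (sym p) q
... | no ¬p | no _ with i
...   | zero   = contradiction refl ¬p
...   | suc i′ = firstIndex-injective (f ∘ suc) i′ (Finₚ.suc-injective eq)

-- An n-vertex graph carries at most n * n colours, so only finitely many
-- colourings matter up to renaming colours.
compress : {G : Graph n} → ProperColouring G → Fin n → Fin n → Fin (suc (n ℕ.* n))
compress {n} χ u v = firstIndex (uncurry (colour χ) ∘ remQuot n) (colour χ u v)

compress-injective : {G : Graph n} (χ : ProperColouring G) → ∀ u v x y →
                     toℕ (compress χ u v) ≡ toℕ (compress χ x y) → colour χ u v ≡ colour χ x y
compress-injective {n} χ u v x y eq =
  trans (sym at-uv)
    (firstIndex-injective (uncurry (colour χ) ∘ remQuot n) (combine u v)
      (trans (cong (firstIndex _) at-uv) (Finₚ.toℕ-injective eq)))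
  where
  at-uv : uncurry (colour χ) (remQuot n (combine u v)) ≡ colour χ u v
  at-uv = cong (uncurry (colour χ)) (Finₚ.remQuot-combine u v)

-- The search runs over tables with `suc (n * n)` colours. Compressing a colouring keeps it proper
-- because `compress` separates different colours, and keeps it rainbow-free because equal colours
-- stay equal.
rainbowFree? : (H : Graph h) (G : Graph n) → Dec (RainbowFree H G)
rainbowFree? {h} {n} H G =
  map′ (λ (_ , χ , _ , free) → χ , free)
       (λ (χ , free) → compress χ , compressed χ , (λ _ _ → refl) , λ R → free (record
          { embed     = RainbowCopy.embed R
          ; injective = RainbowCopy.injective R
          ; edges     = RainbowCopy.edges R
          ; rainbow   = λ a b c d p q r s → RainbowCopy.rainbow R a b c d p q r
              (cong (λ x → toℕ (firstIndex (uncurry (colour χ) ∘ remQuot n) x)) s)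
          }))
       (any-fun₂? (λ eq (χ , col , free) →
                     χ , (λ u v → trans (col u v) (cong toℕ (eq u v))) , free)
                  realises?)
  where
  -- The colouring is only required to agree pointwise with the table, which makes the predicate
  -- respect pointwise equality of tables as `any-fun₂?` demands.
  Realises : (Fin n → Fin n → Fin (suc (n ℕ.* n))) → Set
  Realises c = Σ[ χ ∈ ProperColouring G ]
    (∀ u v → colour χ u v ≡ toℕ (c u v)) × ¬ RainbowCopy H χ

  compressed : ProperColouring G → ProperColouring G
  compressed χ = record
    { colour     = λ u v → toℕ (compress χ u v)
    ; colour-sym = λ u v e →
        cong (λ x → toℕ (firstIndex (uncurry (colour χ) ∘ remQuot n) x)) (colour-sym χ u v e)
    ; proper     = λ u v w e f v≢w eq →
        proper χ u v w e f v≢w (compress-injective χ u v u w eq)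
    }

  realises? : Decidable Realises
  realises? c
    with (Finₚ.all? λ u → Finₚ.all? λ v →
            T? (adj G u v) →-dec (toℕ (c u v) ℕ.≟ toℕ (c v u)))
       ×-dec (Finₚ.all? λ u → Finₚ.all? λ v → Finₚ.all? λ w →
            T? (adj G u v) →-dec (T? (adj G u w) →-dec (¬? (v Fin.≟ w) →-dec
            ¬? (toℕ (c u v) ℕ.≟ toℕ (c u w)))))
  ... | no improper = no λ (χ , col , _) → improper
        ( (λ u v e → trans (sym (col u v)) (trans (colour-sym χ u v e) (col v u)))
        , (λ u v w e f v≢w eq →
             proper χ u v w e f v≢w (trans (col u v) (trans eq (sym (col u w))))))
  ... | yes (c-sym , c-proper) =
    map′ (λ free → χ , (λ _ _ → refl) , free)
         (λ (χ′ , col , free) R → free (record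
            { embed     = RainbowCopy.embed R
            ; injective = RainbowCopy.injective R
            ; edges     = RainbowCopy.edges R
            ; rainbow   = λ a b c d p q r s → RainbowCopy.rainbow R a b c d p q r
                (trans (sym (col _ _)) (trans s (col _ _)))
            }))
         (¬? (rainbowCopy? H χ))
    where
    χ : ProperColouring G
    χ = record { colour = λ u v → toℕ (c u v) ; colour-sym = c-sym ; proper = c-proper }

-- Saturation as edge-maximality

Maximal : Graph h → Graph n → Set
Maximal H G = ∀ u v (u≢v : u ≢ v) → ¬ Adj G u v → ¬ RainbowFree H (addEdge G u v u≢v)

saturated⇒maximal : {H : Graph h} {G : Graph n} →
                    ProperlyRainbowSaturated H G → RainbowFree H G × Maximal H G
saturated⇒maximal (free , sat) = free , λ u v u≢v ¬e (χ , none) → none (sat u v u≢v ¬e χ)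

-- Maximality only refutes the absence of a rainbow copy; since copies can be searched for, the
-- refutation yields an actual one.
maximal⇒saturated : {H : Graph h} {G : Graph n} →
                    RainbowFree H G → Maximal H G → ProperlyRainbowSaturated H G
maximal⇒saturated {H = H} free max = free , λ u v u≢v ¬e χ →
  decidable-stable (rainbowCopy? H χ) λ none → max u v u≢v ¬e (χ , none)

saturated? : (H : Graph h) (G : Graph n) → Dec (ProperlyRainbowSaturated H G)
saturated? H G =
  map′ (uncurry maximal⇒saturated) saturated⇒maximal
    (rainbowFree? H G ×-dec Finₚ.all? λ u → Finₚ.all? λ v → blocked? u v)
  where
  blocked? : ∀ u v → Dec ((u≢v : u ≢ v) → ¬ Adj G u v → ¬ RainbowFree H (addEdge G u v u≢v))
  blocked? u v with u Fin.≟ v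
  ... | yes u≡v = yes λ u≢v → contradiction u≡v u≢v
  ... | no u≢v  =
    -- The statement ranges over every proof of `u ≢ v`; a decision made for one proof is carried
    -- over to all others.
    map′ (λ blocked u≢v′ ¬e free → blocked ¬e
           (rainbowFree-antitone (addEdge-mono {G = G} {G} (λ _ _ e → e) u v u≢v u≢v′) free))
         (λ blocked → blocked u≢v)
         (¬? (T? (adj G u v)) →-dec ¬? (rainbowFree? H (addEdge G u v u≢v)))

-- One greedy pass over all pairs is enough. A pair rejected against an intermediate graph stays
-- rejected against the final one, because a rainbow-free colouring of the larger graph would
-- restrict to the smaller.
saturate : (H : Graph h) (G : Graph n) → RainbowFree H G →
           Σ[ G′ ∈ Graph n ] G ⊆ G′ × ProperlyRainbowSaturated H G′
saturate {n = n} H G free =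
  let G′ , G⊆G′ , free′ , blocked = extend (cartesianProduct (allFin n) (allFin n)) G free
  in G′ , G⊆G′ , maximal⇒saturated free′ λ u v →
       blocked u v (∈-cartesianProduct⁺ (∈-allFin u) (∈-allFin v))
  where
  extend : (ps : List (Fin n × Fin n)) (G : Graph n) → RainbowFree H G →
           Σ[ G′ ∈ Graph n ] G ⊆ G′ × RainbowFree H G′ ×
             (∀ u v → (u , v) ∈ ps → (u≢v : u ≢ v) → ¬ Adj G′ u v →
              ¬ RainbowFree H (addEdge G′ u v u≢v))
  extend [] G free = G , (λ _ _ e → e) , free , λ _ _ ()
  extend ((u , v) ∷ ps) G free with u Fin.≟ v
  ... | yes u≡v =
    let G′ , G⊆G′ , free′ , blocked = extend ps G free
    in G′ , G⊆G′ , free′ , λ where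
         u v (here refl) u≢v → contradiction u≡v u≢v
         u v (there p)       → blocked u v p
  ... | no u≢v with rainbowFree? H (addEdge G u v u≢v)
  ...   | yes free⁺ =
    let G′ , G⁺⊆G′ , free′ , blocked = extend ps (addEdge G u v u≢v) free⁺
    in G′ , (λ x y e → G⁺⊆G′ x y (⊆-addEdge G u v u≢v x y e)) , free′ , λ where
         u v (here refl) _ ¬e → contradiction (G⁺⊆G′ u v (addEdge-adj G u v u≢v)) ¬e
         u v (there p)        → blocked u v p
  ...   | no ¬free⁺ =
    let G′ , G⊆G′ , free′ , blocked = extend ps G free
    in G′ , G⊆G′ , free′ , λ where
         u v (here refl) u≢v′ _ →
           ¬free⁺ ∘ rainbowFree-antitone (addEdge-mono {G = G} {G′} G⊆G′ u v u≢v u≢v′)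
         u v (there p) → blocked u v p

-- Existence of the minimum

-- Graphs are enumerated as 0-1 matrices. A matrix fixes the adjacency but not the two proof fields,
-- so `P` must depend on adjacency alone.
any-graph? : {P : Graph n → Set} →
             (∀ {G G′} → (∀ u v → adj G u v ≡ adj G′ u v) → P G → P G′) →
             Decidable P → Dec (∃ P)
any-graph? {n} {P} resp P? =
  map′ (λ (_ , G , _ , p) → G , p)
       (λ (G , p) → (λ u v → encode (adj G u v)) , G , (λ u v → sym (decode-encode _)) , p)
       (any-fun₂? (λ eq (G , enc , p) → G , (λ u v → trans (enc u v) (cong decode (eq u v))) , p)
                  represents?)
  where
  open Inverse Finₚ.2↔Bool renaming (to to decode; from to encode; strictlyInverseˡ to decode-encode)

  Represents : (Fin n → Fin n → Fin 2) → Set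
  Represents f = Σ[ G ∈ Graph n ] (∀ u v → adj G u v ≡ decode (f u v)) × P G

  represents? : Decidable Represents
  represents? f
    with (Finₚ.all? λ u → Finₚ.all? λ v → decode (f u v) Boolₚ.≟ decode (f v u))
       ×-dec (Finₚ.all? λ u → decode (f u u) Boolₚ.≟ false)
  ... | no bad = no λ (G , enc , _) → bad
        ( (λ u v → trans (sym (enc u v)) (trans (adj-sym G u v) (enc v u)))
        , (λ u → trans (sym (enc u u)) (adj-irrefl G u)))
  ... | yes (f-sym , f-irrefl) =
    map′ (λ p → G , (λ _ _ → refl) , p) (λ (_ , enc , p) → resp enc p) (P? G)
    where
    G : Graph n
    G = record { adj = λ u v → decode (f u v) ; adj-sym = f-sym ; adj-irrefl = f-irrefl }

saturated-resp : {H : Graph h} {G G′ : Graph n} → (∀ u v → adj G u v ≡ adj G′ u v) →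
                 ProperlyRainbowSaturated H G → ProperlyRainbowSaturated H G′
saturated-resp {G = G} {G′} eq sat =
  let free , max = saturated⇒maximal sat
  in maximal⇒saturated (rainbowFree-antitone G′⊆G free) λ u v u≢v ¬e →
       max u v u≢v (¬e ∘ G⊆G′ u v) ∘ rainbowFree-antitone (addEdge-mono {G = G} {G′} G⊆G′ u v u≢v u≢v)
  where
  G⊆G′ : G ⊆ G′
  G⊆G′ u v = subst T (eq u v)

  G′⊆G : G′ ⊆ G
  G′⊆G u v = subst T (sym (eq u v))

edgeCount-cong : {G G′ : Graph n} → (∀ u v → adj G u v ≡ adj G′ u v) → edgeCount G ≡ edgeCount G′
edgeCount-cong eq = sum-cong-≗ λ u → sum-cong-≗ λ v →
  cong (λ b → if _ ∧ b then 1 else 0) (eq u v)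

-- The given saturated graph makes the search for the least attained edge count terminate and bounds
-- its result.
sat*-≤ : (H : Graph h) (G : Graph n) → ProperlyRainbowSaturated H G →
         Σ[ s ∈ ℕ ] IsSat* n H s × s ℕ.≤ edgeCount G
sat*-≤ {n = n} H G sat =
  let s , s≤e , attained , min = least attained? (edgeCount G) (G , sat , refl)
  in s , (attained , λ G′ sat′ → min _ (G′ , sat′ , refl)) , s≤e
  where
  attained? : Decidable λ s → Σ[ G ∈ Graph n ] ProperlyRainbowSaturated H G × edgeCount G ≡ s
  attained? s = any-graph?
    (λ {G} {G′} eq (sat , e≡s) →
       saturated-resp eq sat , trans (sym (edgeCount-cong {G = G} {G′} eq)) e≡s)
    (λ G → saturated? H G ×-dec (edgeCount G ℕ.≟ s))

-- Sums, counting and independent selection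

sum-mono : {f g : Fin n → ℕ} → (∀ i → f i ℕ.≤ g i) → sum f ℕ.≤ sum g
sum-mono {zero}  f≤g = z≤n
sum-mono {suc n} f≤g = ℕₚ.+-mono-≤ (f≤g zero) (sum-mono (f≤g ∘ suc))

sum-≤-* : ∀ {f : Fin n → ℕ} {c} → (∀ i → f i ℕ.≤ c) → sum f ℕ.≤ n ℕ.* c
sum-≤-* {zero}  f≤c = z≤n
sum-≤-* {suc n} f≤c = ℕₚ.+-mono-≤ (f≤c zero) (sum-≤-* (f≤c ∘ suc))

sum-++ : ∀ m {n} (f : Fin (m ℕ.+ n) → ℕ) →
         sum f ≡ sum (λ i → f (i ↑ˡ n)) ℕ.+ sum (λ j → f (m ↑ʳ j))
sum-++ zero    f = refl
sum-++ (suc m) f = trans (cong (f zero ℕ.+_) (sum-++ m (f ∘ suc))) (sym (ℕₚ.+-assoc (f zero) _ _))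

indicator : Bool → ℕ
indicator b = if b then 1 else 0

indicator≤1 : ∀ b → indicator b ℕ.≤ 1
indicator≤1 true  = s≤s z≤n
indicator≤1 false = z≤n

count : (Fin n → Bool) → ℕ
count S = sum λ i → indicator (S i)

count-mono : {S S′ : Fin n → Bool} → (∀ i → T (S i) → T (S′ i)) → count S ℕ.≤ count S′
count-mono S⊆S′ = sum-mono λ i → step _ _ (S⊆S′ i)
  where
  step : ∀ a b → (T a → T b) → indicator a ℕ.≤ indicator b
  step false _     _ = z≤n
  step true  true  _ = s≤s z≤n
  step true  false f = contradiction (f _) λ ()

count≤n : (S : Fin n → Bool) → count S ℕ.≤ n
count≤n S = ℕₚ.≤-trans (sum-≤-* (indicator≤1 ∘ S)) (ℕₚ.≤-reflexive (ℕₚ.*-identityʳ _))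

count<n : (S : Fin n → Bool) → ∀ i → S i ≡ false → count S ℕ.< n
count<n {suc n} S zero    ∉S rewrite ∉S = s≤s (count≤n (S ∘ suc))
count<n {suc n} S (suc i) ∉S = ℕₚ.+-mono-≤-< (indicator≤1 (S zero)) (count<n (S ∘ suc) i ∉S)

count-∖ : (S S′ : Fin n → Bool) →
          count S ≡ count (λ i → S i ∧ S′ i) ℕ.+ count (λ i → S i ∧ not (S′ i))
count-∖ S S′ = trans (sum-cong-≗ λ i → split (S i) (S′ i))
                     (∑-distrib-+ (λ i → indicator (S i ∧ S′ i)) _)
  where
  split : ∀ a b → indicator a ≡ indicator (a ∧ b) ℕ.+ indicator (a ∧ not b)
  split false _     = refl
  split true  false = refl
  split true  true  = refl

count>0⇒∃ : (S : Fin n → Bool) → 0 ℕ.< count S → ∃[ i ] T (S i)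
count>0⇒∃ {suc n} S pos with S zero in eq
... | true  = zero , subst T (sym eq) _
... | false = let i , p = count>0⇒∃ (S ∘ suc) pos in suc i , p

-- Pigeonhole by removing the image of each member from the codomain with `punchOut`. The map
-- receives the membership proof because a code may have to be computed from it.
count-≤ : (S : Fin n → Bool) (f : ∀ i → T (S i) → Fin m) →
          (∀ i j p q → f i p ≡ f j q → i ≡ j) → count S ℕ.≤ m
count-≤ {zero}  S f f-inj = z≤n
count-≤ {suc n} S f f-inj with S zero in eq
count-≤ {suc n} S f f-inj | false =
  count-≤ (S ∘ suc) (f ∘ suc) λ i j p q → Finₚ.suc-injective ∘ f-inj (suc i) (suc j) p q
count-≤ {suc n} {zero}  S f f-inj | true with f zero (subst T (sym eq) _)
... | ()
count-≤ {suc n} {suc m} S f f-inj | true =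
  s≤s (count-≤ (S ∘ suc) (λ i p → punchOut (f0≢ i p)) λ i j p q →
    Finₚ.suc-injective ∘ f-inj _ _ p q ∘ Finₚ.punchOut-injective (f0≢ i p) (f0≢ j q))
  where
  0∈S : T (S zero)
  0∈S = subst T (sym eq) _

  f0≢ : ∀ i p → f zero 0∈S ≢ f (suc i) p
  f0≢ i p = Finₚ.0≢1+n ∘ f-inj _ _ 0∈S p

∈-∧ : ∀ a {b} → T (a ∧ b) → T a × T b
∈-∧ a = Equivalence.to (Boolₚ.T-∧ {a})

-- Pick greedily: each choice discards at most d elements.
greedy-independent :
  (bad : Fin n → Fin n → Bool) → (∀ x y → bad x y ≡ bad y x) →
  ∀ d m (S : Fin n → Bool) → (∀ x → T (S x) → count (λ y → S y ∧ bad x y) ℕ.≤ d) →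
  d ℕ.* m ℕ.< count S →
  Σ[ B ∈ (Fin (suc m) → Fin n) ]
    (∀ i → T (S (B i))) × (∀ i j → i ≢ j → T (not (bad (B i) (B j))))
greedy-independent bad bad-sym d m S few large with count>0⇒∃ S (ℕₚ.≤-<-trans z≤n large)
greedy-independent bad bad-sym d zero S few large | x , x∈S =
  (λ _ → x) , (λ _ → x∈S) , λ where zero zero 0≢0 → contradiction refl 0≢0
greedy-independent bad bad-sym d (suc m) S few large | x , x∈S =
  let B , B∈S′ , indep = greedy-independent bad bad-sym d m S′ few′ large′
  in (λ { zero → x ; (suc i) → B i })
   , (λ { zero → x∈S ; (suc i) → proj₁ (∈-∧ (S (B i)) (B∈S′ i)) })
   , λ where
       zero    zero    0≢0 → contradiction refl 0≢0
       zero    (suc j) _   → proj₂ (∈-∧ (S (B j)) (B∈S′ j))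
       (suc i) zero    _   → subst (T ∘ not) (bad-sym x (B i)) (proj₂ (∈-∧ (S (B i)) (B∈S′ i)))
       (suc i) (suc j) i≢j → indep i j (i≢j ∘ cong suc)
  where
  S′ : Fin _ → Bool
  S′ y = S y ∧ not (bad x y)

  few′ : ∀ y → T (S′ y) → count (λ z → S′ z ∧ bad y z) ℕ.≤ d
  few′ y y∈S′ = ℕₚ.≤-trans
    (count-mono {S = λ z → S′ z ∧ bad y z} λ z p →
      let q , b = ∈-∧ (S′ z) p in Equivalence.from Boolₚ.T-∧ (proj₁ (∈-∧ (S z) q) , b))
    (few y (proj₁ (∈-∧ (S y) y∈S′)))

  large′ : d ℕ.* m ℕ.< count S′
  large′ = ℕₚ.+-cancelˡ-< d (d ℕ.* m) (count S′) (begin-strict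
    d ℕ.+ d ℕ.* m                             ≡⟨ ℕₚ.*-suc d m ⟨
    d ℕ.* suc m                               <⟨ large ⟩
    count S                                   ≡⟨ count-∖ S (bad x) ⟩
    count (λ y → S y ∧ bad x y) ℕ.+ count S′  ≤⟨ ℕₚ.+-monoˡ-≤ (count S′) (few x x∈S) ⟩
    d ℕ.+ count S′                            ∎)
    where open ℕₚ.≤-Reasoning

-- Degrees

degree : Graph n → Fin n → ℕ
degree G u = count (adj G u)

degree<n : (G : Graph n) → ∀ u → degree G u ℕ.< n
degree<n G u = count<n (adj G u) u (adj-irrefl G u)

-- One direction of the handshake lemma. The upper triangle of the adjacency matrix is added to its
-- transpose, and at each position at most one of the two contributes.
2*edgeCount≤∑degree : (G : Graph n) → 2 ℕ.* edgeCount G ℕ.≤ sum (degree G)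
2*edgeCount≤∑degree G = begin
  2 ℕ.* edgeCount G
    ≡⟨ cong (edgeCount G ℕ.+_) (ℕₚ.+-identityʳ _) ⟩
  (sum λ u → sum λ v → up u v) ℕ.+ (sum λ u → sum λ v → up u v)
    ≡⟨ cong ((sum λ u → sum λ v → up u v) ℕ.+_) (∑-comm up) ⟩
  (sum λ u → sum λ v → up u v) ℕ.+ (sum λ u → sum λ v → up v u)
    ≡⟨ ∑-distrib-+ (λ u → sum λ v → up u v) _ ⟨
  (sum λ u → (sum λ v → up u v) ℕ.+ (sum λ v → up v u))
    ≡⟨ (sum-cong-≗ λ u → sym (∑-distrib-+ (up u) (λ v → up v u))) ⟩
  (sum λ u → sum λ v → up u v ℕ.+ up v u)
    ≤⟨ (sum-mono λ u → sum-mono (up+down u)) ⟩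
  sum (degree G) ∎
  where
  open ℕₚ.≤-Reasoning

  up : Fin _ → Fin _ → ℕ
  up u v = indicator (⌊ u Fin.<? v ⌋ ∧ adj G u v)

  up+down : ∀ u v → up u v ℕ.+ up v u ℕ.≤ indicator (adj G u v)
  up+down u v rewrite adj-sym G v u with u Fin.<? v | v Fin.<? u
  ... | yes u<v | yes v<u = contradiction v<u (ℕₚ.<-asym u<v)
  ... | yes _   | no _    = ℕₚ.≤-reflexive (ℕₚ.+-identityʳ _)
  ... | no _    | yes _   = ℕₚ.≤-refl
  ... | no _    | no _    = z≤n

-- Rainbow copies of complete bipartite graphs

data Side (k ℓ : ℕ) : Fin (k ℕ.+ ℓ) → Set where
  left  : ∀ i → Side k ℓ (i ↑ˡ ℓ)
  right : ∀ j → Side k ℓ (k ↑ʳ j)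

side : ∀ k {ℓ} (a : Fin (k ℕ.+ ℓ)) → Side k ℓ a
side k a with splitAt k a in eq
... | inj₁ i = subst (Side k _) (Finₚ.splitAt⁻¹-↑ˡ eq) (left i)
... | inj₂ j = subst (Side k _) (Finₚ.splitAt⁻¹-↑ʳ eq) (right j)

left-right : ∀ k ℓ i j → Adj (completeBipartite k ℓ) (i ↑ˡ ℓ) (k ↑ʳ j)
left-right k ℓ i j rewrite Finₚ.splitAt-↑ˡ k i ℓ | Finₚ.splitAt-↑ʳ k ℓ j = _

¬left-left : ∀ k ℓ i i′ → ¬ Adj (completeBipartite k ℓ) (i ↑ˡ ℓ) (i′ ↑ˡ ℓ)
¬left-left k ℓ i i′ rewrite Finₚ.splitAt-↑ˡ k i ℓ | Finₚ.splitAt-↑ˡ k i′ ℓ = λ ()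

¬right-right : ∀ k ℓ j j′ → ¬ Adj (completeBipartite k ℓ) (k ↑ʳ j) (k ↑ʳ j′)
¬right-right k ℓ j j′ rewrite Finₚ.splitAt-↑ʳ k ℓ j | Finₚ.splitAt-↑ʳ k ℓ j′ = λ ()

-- An edge shows up as two ordered pairs; there is one constructor for each orientation.
data Crossing (k ℓ : ℕ) : (a b : Fin (k ℕ.+ ℓ)) → Set where
  →ʳ : ∀ i j → Crossing k ℓ (i ↑ˡ ℓ) (k ↑ʳ j)
  →ˡ : ∀ i j → Crossing k ℓ (k ↑ʳ j) (i ↑ˡ ℓ)

crossing : ∀ k ℓ a b → Adj (completeBipartite k ℓ) a b → Crossing k ℓ a b
crossing k ℓ a b e with side k {ℓ} a | side k {ℓ} b
... | left i  | left i′  = contradiction e (¬left-left k ℓ i i′)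
... | left i  | right j  = →ʳ i j
... | right j | left i   = →ˡ i j
... | right j | right j′ = contradiction e (¬right-right k ℓ j j′)

adj-swap : (G : Graph n) → ∀ {u v} → Adj G u v → Adj G v u
adj-swap G {u} {v} = subst T (adj-sym G u v)

adj⇒≢ : (G : Graph n) → ∀ {u v} → Adj G u v → u ≢ v
adj⇒≢ G {u} e refl = subst T (adj-irrefl G u) e

module _ {G : Graph n} (χ : ProperColouring G) (A : Fin k → Fin n) (B : Fin ℓ → Fin n)
         (A-injective : Injective _≡_ _≡_ A) (B-injective : Injective _≡_ _≡_ B)
         (complete : ∀ i j → Adj G (A i) (B j))
         (distinct : ∀ i i′ j j′ → i ≢ i′ → j ≢ j′ → colour χ (A i) (B j) ≢ colour χ (A i′) (B j′))
         where

  -- The hypothesis `distinct` speaks of vertex-disjoint edges only: two edges sharing an endpoint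
  -- differ in colour by properness. The images of `A` and `B` are disjoint because adjacent
  -- vertices are distinct.
  rainbowBipartite : RainbowCopy (completeBipartite k ℓ) χ
  rainbowBipartite = record
    { embed     = place
    ; injective = place-injective _ _
    ; edges     = λ a b e → place-edge (crossing k ℓ a b e)
    ; rainbow   = λ a b c d e f → place-rainbow (crossing k ℓ a b e) (crossing k ℓ c d f)
    }
    where
    place : Fin (k ℕ.+ ℓ) → Fin n
    place a = [ A , B ]′ (splitAt k a)

    place-left : ∀ i → place (i ↑ˡ ℓ) ≡ A i
    place-left i = cong [ A , B ]′ (Finₚ.splitAt-↑ˡ k i ℓ)

    place-right : ∀ j → place (k ↑ʳ j) ≡ B j
    place-right j = cong [ A , B ]′ (Finₚ.splitAt-↑ʳ k ℓ j)

    place-injective : ∀ a b → place a ≡ place b → a ≡ b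
    place-injective a b eq with side k {ℓ} a | side k {ℓ} b
    ... | left i  | left i′  =
      cong (_↑ˡ ℓ) (A-injective (trans (sym (place-left i)) (trans eq (place-left i′))))
    ... | left i  | right j  = contradiction
      (trans (sym (place-left i)) (trans eq (place-right j))) (adj⇒≢ G (complete i j))
    ... | right j | left i   = contradiction
      (trans (sym (place-left i)) (trans (sym eq) (place-right j))) (adj⇒≢ G (complete i j))
    ... | right j | right j′ =
      cong (k ↑ʳ_) (B-injective (trans (sym (place-right j)) (trans eq (place-right j′))))

    place-edge : ∀ {a b} → Crossing k ℓ a b → Adj G (place a) (place b)
    place-edge (→ʳ i j) rewrite place-left i | place-right j = complete i j
    place-edge (→ˡ i j) rewrite place-left i | place-right j = adj-swap G (complete i j)

    swap-colour : ∀ i j → colour χ (B j) (A i) ≡ colour χ (A i) (B j)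
    swap-colour i j = colour-sym χ _ _ (adj-swap G (complete i j))

    cross : ∀ i j i′ j′ → ¬ (i ≡ i′ × j ≡ j′) → colour χ (A i) (B j) ≢ colour χ (A i′) (B j′)
    cross i j i′ j′ diff with i Fin.≟ i′ | j Fin.≟ j′
    ... | yes refl | yes refl = contradiction (refl , refl) diff
    ... | yes refl | no j≢j′  =
      proper χ _ _ _ (complete i j) (complete i j′) (j≢j′ ∘ B-injective)
    ... | no i≢i′  | no j≢j′  = distinct i i′ j j′ i≢i′ j≢j′
    -- The shared endpoint is `B j`, so both edges are turned round before properness is applied
    -- there.
    ... | no i≢i′  | yes refl = λ eq →
      proper χ _ _ _ (adj-swap G (complete i j)) (adj-swap G (complete i′ j)) (i≢i′ ∘ A-injective)
        (trans (swap-colour i j) (trans eq (sym (swap-colour i′ j))))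

    place-rainbow : ∀ {a b c d} → Crossing k ℓ a b → Crossing k ℓ c d → ¬ SameEdge a b c d →
                    colour χ (place a) (place b) ≢ colour χ (place c) (place d)
    place-rainbow (→ʳ i j) (→ʳ i′ j′) ≁
      rewrite place-left i | place-right j | place-left i′ | place-right j′ =
      cross i j i′ j′ λ { (refl , refl) → ≁ (inj₁ (refl , refl)) }
    place-rainbow (→ʳ i j) (→ˡ i′ j′) ≁
      rewrite place-left i | place-right j | place-left i′ | place-right j′ | swap-colour i′ j′ =
      cross i j i′ j′ λ { (refl , refl) → ≁ (inj₂ (refl , refl)) }
    place-rainbow (→ˡ i j) (→ʳ i′ j′) ≁
      rewrite place-left i | place-right j | place-left i′ | place-right j′ | swap-colour i j =
      cross i j i′ j′ λ { (refl , refl) → ≁ (inj₂ (refl , refl)) }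
    place-rainbow (→ˡ i j) (→ˡ i′ j′) ≁
      rewrite place-left i | place-right j | place-left i′ | place-right j′
            | swap-colour i j | swap-colour i′ j′ =
      cross i j i′ j′ λ { (refl , refl) → ≁ (inj₁ (refl , refl)) }

-- A conflict between x and y fixes a pair of distinct indices i, i′, and the
-- pair together with x determines y because the colouring is proper at A i′.
commonNeighbours-≤ :
  ∀ {G : Graph n} (χ : ProperColouring G) {k ℓ} →
  ¬ RainbowCopy (completeBipartite (suc k) (suc ℓ)) χ →
  (A : Fin (suc k) → Fin n) → Injective _≡_ _≡_ A →
  (f : Fin r → Fin n) → Injective _≡_ _≡_ f →
  (S : Fin r → Bool) → (∀ x → T (S x) → ∀ i → Adj G (A i) (f x)) →
  count S ℕ.≤ suc (suc k ℕ.* k) ℕ.* ℓ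
commonNeighbours-≤ {r = r} {G = G} χ {k} {ℓ} free A A-injective f f-injective S joined =
  ℕₚ.≮⇒≥ λ large →
    -- More than `d * ℓ` candidates, with `d = suc (suc k * k)`, give `suc ℓ` conflict-free ones:
    -- the second part of the forbidden graph.
    let B , B∈S , indep = greedy-independent bad bad-sym (suc (suc k ℕ.* k)) ℓ S few large
        bad-free : ∀ i j → i ≢ j → ¬ Conflict (B i) (B j)
        bad-free i j i≢j c = not-both (indep i j i≢j) (fromWitness c)
    in free (rainbowBipartite χ A (f ∘ B) A-injective
         (λ {i} {j} eq → decidable-stable (i Fin.≟ j) λ i≢j →
            bad-free i j i≢j (inj₁ (f-injective eq)))
         (λ i j → joined (B j) (B∈S j) i)
         (λ i i′ j j′ i≢i′ j≢j′ eq → bad-free j j′ j≢j′ (inj₂ (i , i′ , i≢i′ , eq))))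
  where
  col : Fin (suc k) → Fin r → ℕ
  col i x = colour χ (A i) (f x)

  -- Equality counts as a conflict, so that a conflict-free family consists of distinct vertices.
  -- This accounts for the outer `suc` in `suc (suc k * k)`.
  Conflict : Fin r → Fin r → Set
  Conflict x y = x ≡ y ⊎ ∃[ i ] ∃[ i′ ] i ≢ i′ × col i x ≡ col i′ y

  conflict? : ∀ x y → Dec (Conflict x y)
  conflict? x y = (x Fin.≟ y) ⊎-dec
    (Finₚ.any? λ i → Finₚ.any? λ i′ → ¬? (i Fin.≟ i′) ×-dec (col i x ℕ.≟ col i′ y))

  bad : Fin r → Fin r → Bool
  bad x y = ⌊ conflict? x y ⌋

  not-both : ∀ {b} → T (not b) → ¬ T b
  not-both {true} ()

  conflict-sym : ∀ {x y} → Conflict x y → Conflict y x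
  conflict-sym (inj₁ eq)                   = inj₁ (sym eq)
  conflict-sym (inj₂ (i , i′ , i≢i′ , eq)) = inj₂ (i′ , i , i≢i′ ∘ sym , sym eq)

  bad-sym : ∀ x y → bad x y ≡ bad y x
  bad-sym x y with conflict? x y | conflict? y x
  ... | yes _ | yes _ = refl
  ... | no _  | no _  = refl
  ... | yes c | no ¬c = contradiction (conflict-sym c) ¬c
  ... | no ¬c | yes c = contradiction (conflict-sym c) ¬c

  -- The `suc k * k` nonzero codes are the ordered pairs of distinct indices: `i` is free, and `i′`
  -- is recorded with `i` punched out.
  code : ∀ {x y} → Conflict x y → Fin (suc (suc k ℕ.* k))
  code (inj₁ _)                  = zero
  code (inj₂ (i , i′ , i≢i′ , _)) = suc (combine i (punchOut i≢i′))

  code-injective : ∀ {x y z} (c : Conflict x y) (d : Conflict x z) →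
                   T (S y) → T (S z) → code c ≡ code d → y ≡ z
  code-injective (inj₁ refl) (inj₁ refl) _ _ _ = refl
  code-injective {y = y} {z} (inj₂ (i , i′ , i≢i′ , eq)) (inj₂ (j , j′ , j≢j′ , eq′)) y∈S z∈S same
    with Finₚ.combine-injective i _ j _ (Finₚ.suc-injective same)
  ... | refl , same′ with Finₚ.punchOut-injective i≢i′ j≢j′ same′
  ...   | refl = decidable-stable (y Fin.≟ z) λ y≢z →
    proper χ _ _ _ (joined y y∈S i′) (joined z z∈S i′) (y≢z ∘ f-injective) (trans (sym eq) eq′)

  few : ∀ x → T (S x) → count (λ y → S y ∧ bad x y) ℕ.≤ suc (suc k ℕ.* k)
  few x _ = count-≤ _ (λ y p → code (conflict p)) λ y z p q →
    code-injective (conflict p) (conflict q) (proj₁ (∈-∧ (S y) p)) (proj₁ (∈-∧ (S z) q))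
    where
    conflict : ∀ {y} → T (S y ∧ bad x y) → Conflict x y
    conflict {y} p = toWitness (proj₂ (∈-∧ (S y) p))

-- Every edge of a K_{m,r} meets a part of size m, whereas K_{m+1,ℓ} with ℓ > m
-- has no vertex cover of size m.
bipartite-noCopy : ∀ {m ℓ r} → m ℕ.< ℓ → (χ : ProperColouring (completeBipartite m r)) →
                   ¬ RainbowCopy (completeBipartite (suc m) ℓ) χ
bipartite-noCopy {m} {suc ℓ} {r} m<ℓ χ R =
  separated (crossing m r _ _ (edges _ _ base)) refl refl
  where
  open RainbowCopy R

  base : Adj (completeBipartite (suc m) (suc ℓ)) (zero ↑ˡ suc ℓ) (suc m ↑ʳ zero)
  base = left-right (suc m) (suc ℓ) zero zero

  confined : ∀ {p} (g : Fin p → Fin (suc m ℕ.+ suc ℓ)) → Injective _≡_ _≡_ g →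
             (∀ x → ∃[ i ] embed (g x) ≡ i ↑ˡ r) → p ℕ.≤ m
  confined g g-inj into = Finₚ.injective⇒≤ {f = proj₁ ∘ into} λ {x} {y} eq →
    g-inj (injective (trans (proj₂ (into x)) (trans (cong (_↑ˡ r) eq) (sym (proj₂ (into y))))))

  opposite : ∀ {u v j} → Crossing m r u v → m ↑ʳ j ≡ u → ∃[ i ] v ≡ i ↑ˡ r
  opposite (→ˡ i _) _  = i , refl
  opposite (→ʳ i j) eq = contradiction (sym eq) (adj⇒≢ (completeBipartite m r) (left-right m r i _))

  -- The ends of the embedded base edge enter as variables with equations, so that `Crossing` can be
  -- matched. One of them lies in the part of size `r`, and then all its neighbours in the copy are
  -- confined to the part of size `m`: either `suc ℓ` of them or `suc m`, too many in both cases.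
  separated : ∀ {u v} → Crossing m r u v →
              u ≡ embed (zero ↑ˡ suc ℓ) → v ≡ embed (suc m ↑ʳ zero) → ⊥
  separated (→ˡ _ j) at-u _ = ℕₚ.<⇒≱ m<ℓ
    (confined (suc m ↑ʳ_) (Finₚ.↑ʳ-injective (suc m) _ _) λ y →
      opposite (crossing m r _ _ (edges _ _ (left-right (suc m) (suc ℓ) zero y))) at-u)
  separated (→ʳ _ j) _ at-v = ℕₚ.1+n≰n
    (confined (_↑ˡ suc ℓ) (Finₚ.↑ˡ-injective (suc ℓ) _ _) λ x →
      opposite (crossing m r _ _ (edges _ _ (adj-swap (completeBipartite (suc m) (suc ℓ))
        {x ↑ˡ suc ℓ} {suc m ↑ʳ zero} (left-right (suc m) (suc ℓ) x zero)))) at-v)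

-- The saturated supergraph and its degree sum

-- Labels add symmetrically, and a common summand cancels. As `bipartite-noCopy` holds for every
-- colouring, a starting colouring needs no other property.
sumColouring : (G : Graph n) → ProperColouring G
sumColouring G = record
  { colour     = λ u v → toℕ u ℕ.+ toℕ v
  ; colour-sym = λ u v _ → ℕₚ.+-comm (toℕ u) (toℕ v)
  ; proper     = λ u v w _ _ v≢w → v≢w ∘ Finₚ.toℕ-injective ∘ ℕₚ.+-cancelˡ-≡ (toℕ u) _ _
  }

module _ {k ℓ r : ℕ} (G : Graph (k ℕ.+ r)) (K⊆G : completeBipartite k r ⊆ G)
         (free : RainbowFree (completeBipartite (suc k) (suc ℓ)) G) where

  -- Neighbours in the part of size `k` contribute at most `k`. The others are common neighbours of
  -- the `suc k` vertices of `A`: the vertex itself and that whole part.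
  degree-right : ∀ j → degree G (k ↑ʳ j) ℕ.≤ k ℕ.+ suc (suc k ℕ.* k) ℕ.* ℓ
  degree-right j = begin
    degree G (k ↑ʳ j)
      ≡⟨ sum-++ k (λ v → indicator (adj G (k ↑ʳ j) v)) ⟩
    count (λ i → adj G (k ↑ʳ j) (i ↑ˡ r)) ℕ.+ count (λ x → adj G (k ↑ʳ j) (k ↑ʳ x))
      ≤⟨ ℕₚ.+-mono-≤ (count≤n (λ i → adj G (k ↑ʳ j) (i ↑ˡ r)))
           (commonNeighbours-≤ (proj₁ free) (proj₂ free) A A-injective
             (k ↑ʳ_) (Finₚ.↑ʳ-injective k _ _) _ joined) ⟩
    k ℕ.+ suc (suc k ℕ.* k) ℕ.* ℓ ∎
    where
    open ℕₚ.≤-Reasoning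

    A : Fin (suc k) → Fin (k ℕ.+ r)
    A zero    = k ↑ʳ j
    A (suc i) = i ↑ˡ r

    left≢right : ∀ i → i ↑ˡ r ≢ k ↑ʳ j
    left≢right i = adj⇒≢ G (K⊆G _ _ (left-right k r i j))

    A-injective : Injective _≡_ _≡_ A
    A-injective {zero}  {zero}   _  = refl
    A-injective {zero}  {suc i}  eq = contradiction (sym eq) (left≢right i)
    A-injective {suc i} {zero}   eq = contradiction eq (left≢right i)
    A-injective {suc i} {suc i′} eq = cong suc (Finₚ.↑ˡ-injective r i i′ eq)

    joined : ∀ x → Adj G (k ↑ʳ j) (k ↑ʳ x) → ∀ i → Adj G (A i) (k ↑ʳ x)
    joined x e zero    = e
    joined x e (suc i) = K⊆G _ _ (left-right k r i x)

  edges-≤ : 2 ℕ.* edgeCount G ℕ.≤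
            k ℕ.* (k ℕ.+ r ℕ.∸ 1) ℕ.+ r ℕ.* (k ℕ.+ suc (suc k ℕ.* k) ℕ.* ℓ)
  edges-≤ = begin
    2 ℕ.* edgeCount G  ≤⟨ 2*edgeCount≤∑degree G ⟩
    sum (degree G)     ≡⟨ sum-++ k (degree G) ⟩
    sum (λ i → degree G (i ↑ˡ r)) ℕ.+ sum (λ j → degree G (k ↑ʳ j))
      ≤⟨ ℕₚ.+-mono-≤ (sum-≤-* λ i → ℕₚ.<⇒≤pred (degree<n G (i ↑ˡ r)))
                     (sum-≤-* degree-right) ⟩
    k ℕ.* ℕ.pred (k ℕ.+ r) ℕ.+ r ℕ.* (k ℕ.+ suc (suc k ℕ.* k) ℕ.* ℓ) ∎
    where open ℕₚ.≤-Reasoning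

sat*-bipartite-≤ : ∀ {k ℓ} r → k ℕ.≤ ℓ →
  Σ[ s ∈ ℕ ] IsSat* (k ℕ.+ r) (completeBipartite (suc k) (suc ℓ)) s ×
    2 ℕ.* s ℕ.≤ k ℕ.* (k ℕ.+ r ℕ.∸ 1) ℕ.+ r ℕ.* (k ℕ.+ suc (suc k ℕ.* k) ℕ.* ℓ)
sat*-bipartite-≤ {k} {ℓ} r k≤ℓ =
  let G , K⊆G , sat = saturate (completeBipartite (suc k) (suc ℓ)) (completeBipartite k r)
                        (sumColouring _ , bipartite-noCopy (s≤s k≤ℓ) (sumColouring _))
      s , isSat , s≤e = sat*-≤ _ G sat
  in s , isSat , ℕₚ.≤-trans (ℕₚ.*-monoʳ-≤ 2 s≤e) (edges-≤ G K⊆G (proj₁ sat))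

-- Comparison with the stated rational bound

bound : ℚᵘ → ℚᵘ → ℚᵘ → ℚᵘ
bound K L N =
  ((K - 1ℚᵘ) + (K * (K - 1ℚᵘ) + 1ℚᵘ) * (L - 1ℚᵘ) * ½) * N
  - ((K * ((K - 1ℚᵘ) * (K - 1ℚᵘ)) + 1ℚᵘ) * (L - 1ℚᵘ) + K * (K - 1ℚᵘ)) * ½

-- The left side is the numerator of `bound` as ℚᵘ computes it, over the
-- denominator 4, at K = A + 2, L = B + 1 and N = A + 1 + R.
numerator : ∀ A B R →
  let K  = + 2 ℤ.+ A
      K₁ = K ℤ.* + 1 ℤ.+ -[1+ 0 ] ℤ.* + 1
      L₁ = (+ 1 ℤ.+ B) ℤ.* + 1 ℤ.+ -[1+ 0 ] ℤ.* + 1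
  in ((K₁ ℤ.* + 2 ℤ.+ (K ℤ.* K₁ ℤ.* + 1 ℤ.+ + 1 ℤ.* + 1) ℤ.* L₁ ℤ.* + 1 ℤ.* + 1)
        ℤ.* (+ 1 ℤ.+ A ℤ.+ R)) ℤ.* + 2
     ℤ.+ ℤ.- (((K ℤ.* (K₁ ℤ.* K₁) ℤ.* + 1 ℤ.+ + 1 ℤ.* + 1) ℤ.* L₁ ℤ.* + 1
               ℤ.+ K ℤ.* K₁ ℤ.* + 1) ℤ.* + 1) ℤ.* + 2
     ≡ + 2 ℤ.* ((+ 1 ℤ.+ A) ℤ.* (A ℤ.+ R)
                ℤ.+ R ℤ.* (+ 1 ℤ.+ A ℤ.+ (+ 1 ℤ.+ (+ 2 ℤ.+ A) ℤ.* (+ 1 ℤ.+ A)) ℤ.* B)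
                ℤ.+ A ℤ.* B)
numerator = solve-∀

-- The bound on `2 * s` from `sat*-bipartite-≤` at `k = suc a` and `ℓ = b`, where `suc a + r ∸ 1`
-- computes to `a + r`.
doubled : (a b r : ℕ) → ℕ
doubled a b r = suc a ℕ.* (a ℕ.+ r) ℕ.+ r ℕ.* (suc a ℕ.+ suc (suc (suc a) ℕ.* suc a) ℕ.* b)

-- The summand `a * b` is slack: over the denominator 4, the stated bound exceeds half of
-- `doubled a b r` by `a * b / 2`, that is, by (k - 2)(ℓ - 1)/2 in the parameters of the theorem.
↥-bound : ∀ a b r → ↥ (bound (fromℕ (suc (suc a))) (fromℕ (suc b)) (fromℕ (suc a ℕ.+ r))) ≡
          + (2 ℕ.* (doubled a b r ℕ.+ a ℕ.* b))
↥-bound a b r = trans (numerator (+ a) (+ b) (+ r)) (sym (begin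
  + (2 ℕ.* (doubled a b r ℕ.+ a ℕ.* b))
    ≡⟨ ℤₚ.pos-* 2 (doubled a b r ℕ.+ a ℕ.* b) ⟩
  + 2 ℤ.* (+ (suc a ℕ.* (a ℕ.+ r)) ℤ.+ + (r ℕ.* (suc a ℕ.+ suc (suc (suc a) ℕ.* suc a) ℕ.* b))
           ℤ.+ + (a ℕ.* b))
    ≡⟨ cong (+ 2 ℤ.*_) (cong₂ ℤ._+_ (cong₂ ℤ._+_ (ℤₚ.pos-* (suc a) (a ℕ.+ r))
         (trans (ℤₚ.pos-* r _) (cong (λ x → + r ℤ.* (+ suc a ℤ.+ x))
           (trans (ℤₚ.pos-* (suc (suc (suc a) ℕ.* suc a)) b)
             (cong (λ x → (+ 1 ℤ.+ x) ℤ.* + b) (ℤₚ.pos-* (suc (suc a)) (suc a)))))))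
         (ℤₚ.pos-* a b)) ⟩
  + 2 ℤ.* ((+ 1 ℤ.+ + a) ℤ.* (+ a ℤ.+ + r)
           ℤ.+ + r ℤ.* (+ 1 ℤ.+ + a ℤ.+ (+ 1 ℤ.+ (+ 2 ℤ.+ + a) ℤ.* (+ 1 ℤ.+ + a)) ℤ.* + b)
           ℤ.+ + a ℤ.* + b) ∎))
  where open ≡-Reasoning

≤-bound : ∀ a b r {s} → 2 ℕ.* s ℕ.≤ doubled a b r →
          fromℕ s ≤ bound (fromℕ (suc (suc a))) (fromℕ (suc b)) (fromℕ (suc a ℕ.+ r))
≤-bound a b r {s} 2s≤ = *≤* (begin
  + s ℤ.* + 4                               ≡⟨ ℤₚ.pos-* s 4 ⟨
  + (s ℕ.* 4)                               ≤⟨ ℤ.+≤+ 4s≤ ⟩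
  + (2 ℕ.* (doubled a b r ℕ.+ a ℕ.* b))     ≡⟨ ↥-bound a b r ⟨
  ↥ B                                       ≡⟨ ℤₚ.*-identityʳ (↥ B) ⟨
  ↥ B ℤ.* + 1                               ∎)
  where
  open ℤₚ.≤-Reasoning

  B : ℚᵘ
  B = bound (fromℕ (suc (suc a))) (fromℕ (suc b)) (fromℕ (suc a ℕ.+ r))

  4s≤ : s ℕ.* 4 ℕ.≤ 2 ℕ.* (doubled a b r ℕ.+ a ℕ.* b)
  4s≤ = ℕₚ.≤-trans (ℕₚ.≤-reflexive (trans (ℕₚ.*-comm s 4) (ℕₚ.*-assoc 2 2 s)))
    (ℕₚ.*-monoʳ-≤ 2 (ℕₚ.≤-trans 2s≤ (ℕₚ.m≤m+n _ _)))

theorem1p4 : (k ℓ n : ℕ) → 2 ℕ.≤ k → k ℕ.≤ ℓ → k ℕ.+ ℓ ℕ.≤ n →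
  let K = fromℕ k
      L = fromℕ ℓ
      N = fromℕ n
  in Σ[ s ∈ ℕ ] IsSat* n (completeBipartite k ℓ) s ×
     fromℕ s ≤ ((K - 1ℚᵘ) + (K * (K - 1ℚᵘ) + 1ℚᵘ) * (L - 1ℚᵘ) * ½) * N
               - ((K * ((K - 1ℚᵘ) * (K - 1ℚᵘ)) + 1ℚᵘ) * (L - 1ℚᵘ) + K * (K - 1ℚᵘ)) * ½
theorem1p4 (suc (suc a)) (suc b) n (s≤s (s≤s z≤n)) (s≤s k≤ℓ) k+ℓ≤n
  -- Here `n` is split as (k - 1) + `r`, which fixes the part sizes of the starting complete
  -- bipartite graph.
  with ℕₚ.m≤n⇒∃[o]m+o≡n (ℕₚ.≤-trans (ℕₚ.n≤1+n (suc a)) (ℕₚ.m+n≤o⇒m≤o (suc (suc a)) k+ℓ≤n))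
... | r , refl =
  let s , isSat , 2s≤ = sat*-bipartite-≤ r k≤ℓ
  in s , isSat , ≤-bound a b r 2s≤
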